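{- For any theory $\Sigma$ and any formula $A \Rightarrow B$, the following are equivalent: (1) $\Sigma \models A \Rightarrow B$; (2) $[A]_\Sigma \models A \Rightarrow B$; (3) $B \subseteq [A]_\Sigma$.
   Context: $Y$ is a non-empty finite set of attributes and $\mathcal{T}_Y = \{y^i \mid y \in Y, i \in \mathbb{Z}\}$. For $M \subseteq \mathcal{T}_Y$ and $j \in \mathbb{Z}$, $M + j = \{y^{i+j} \mid y^i \in M\}$. A formula is $A \Rightarrow B$ with $A,B$ finite subsets of $\mathcal{T}_Y$; $M \models A \Rightarrow B$ means that for every $i \in \mathbb{Z}$, $A+i \subseteq M$ implies $B+i \subseteq M$. For a theory $\Sigma$, $\mathrm{Mod}(\Sigma)$ is the set of all $M \subseteq \mathcal{T}_Y$ in which all formulas of $\Sigma$ are true; $\Sigma \models A \Rightarrow B$ means $M \models A \Rightarrow B$ for all $M \in \mathrm{Mod}(\Sigma)$; $[M]_\Sigma = \bigcap\{N \in \mathrm{Mod}(\Sigma) \mid M \subseteq N\}$. -}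

module Defs where

open import Data.Integer using (ℤ; _+_)
open import Data.List using (List)
import Data.List.Membership.Propositional as List
open import Data.Product using (_×_; _,_; ∃-syntax)
open import Level using (Level; _⊔_) renaming (suc to lsuc)
open import Relation.Binary.PropositionalEquality using (_≡_)
open import Relation.Unary using (Pred; _∈_; _⊆_)

private
  variable
    Y : Set
    m ℓ s : Level

-- The pair (y , i) is the attribute y annotated by the time point i, i.e. yⁱ.
𝒯 : Set → Set
𝒯 Y = Y × ℤ

infixl 6 _⊕_

_⊕_ : Pred (𝒯 Y) m → ℤ → Pred (𝒯 Y) m
(M ⊕ j) t = ∃[ y ] ∃[ i ] ((y , i) ∈ M × t ≡ (y , i + j))

-- Finite subsets of 𝒯 Y are given by lists of their elements; order and
-- repetition are irrelevant since only the underlying set ⟦_⟧ is ever used.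
FinSubset : Set → Set
FinSubset Y = List (𝒯 Y)

⟦_⟧ : FinSubset Y → Pred (𝒯 Y) Level.zero
⟦ A ⟧ t = t List.∈ A

infix 5 _⇒_

record Formula (Y : Set) : Set where
  constructor _⇒_
  field
    antecedent consequent : FinSubset Y

Theory : Set → (s : Level) → Set (lsuc s)
Theory Y s = Pred (Formula Y) s

infix 4 _⊨_

_⊨_ : Pred (𝒯 Y) m → Formula Y → Set m
M ⊨ (A ⇒ B) = ∀ (i : ℤ) → ⟦ A ⟧ ⊕ i ⊆ M → ⟦ B ⟧ ⊕ i ⊆ M

-- Agda being predicative, "all subsets" has to mean all predicates of some
-- level ℓ. The intersection [ M ]⟨ ℓ , Σ ⟩ of the models of level ℓ then lives
-- in a larger universe, which is why M in _⊨_ may be of any level.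
Mod : ∀ ℓ → Theory Y s → Pred (Pred (𝒯 Y) ℓ) (s ⊔ ℓ)
Mod ℓ Σ M = ∀ {φ} → φ ∈ Σ → M ⊨ φ

infix 4 _⊨⟨_⟩_

_⊨⟨_⟩_ : Theory Y s → (ℓ : Level) → Formula Y → Set (s ⊔ lsuc ℓ)
Σ ⊨⟨ ℓ ⟩ φ = ∀ M → M ∈ Mod ℓ Σ → M ⊨ φ

[_]⟨_,_⟩ : Pred (𝒯 Y) m → (ℓ : Level) → Theory Y s → Pred (𝒯 Y) (m ⊔ s ⊔ lsuc ℓ)
[ M ]⟨ ℓ , Σ ⟩ t = ∀ N → N ∈ Mod ℓ Σ → M ⊆ N → t ∈ N

{-# OPTIONS --safe #-}
-- Models are closed under time shifts. Hence, if A + i ⊆ M for a model M, then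
-- M − i is a model containing A, so it contains [A]; thus B ⊆ [A] gives B ⊆ M − i,
-- that is, B + i ⊆ M.
module Submission where

open import Defs
open import Data.Fin using (Fin)
open import Data.Integer using (ℤ; _+_; 0ℤ)
open import Data.Integer.Properties using (+-assoc; +-identityʳ)
open import Data.Nat using (ℕ; suc)
open import Data.Product using (_×_; _,_)
open import Function.Base using (_∘_)
open import Function.Bundles using (_↔_; _⇔_; mk⇔)
open import Level using (Level)
open import Relation.Binary.PropositionalEquality using (refl; sym; cong; subst)
open import Relation.Unary using (Pred; _∈_; _⊆_)

-- The three statements are proved in a cycle. Truth of a formula passes to intersections of models,
-- and the closure `[ ⟦ A ⟧ ]⟨ ℓ , Σ ⟩` is one, so (1) gives (2). As A lies in its closure, the
-- instance of (2) at shift 0 is (3). The return to (1) rests on `⊨-⊖`: a time shift of a model is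
-- again a model.

private
  variable
    Y : Set
    k ℓ m s : Level

infixl 6 _⊖_

-- The set M + (-i), encoded as a preimage so that membership computes without an existential. For
-- inclusion, `_⊖ i` is right adjoint to `_⊕ i`.
_⊖_ : Pred (𝒯 Y) m → ℤ → Pred (𝒯 Y) m
(M ⊖ i) (y , j) = (y , j + i) ∈ M

⊕⊆⇒⊆⊖ : {L : Pred (𝒯 Y) k} {M : Pred (𝒯 Y) m} {i : ℤ} → L ⊕ i ⊆ M → L ⊆ M ⊖ i
⊕⊆⇒⊆⊖ L+i⊆M {y , j} p = L+i⊆M (y , j , p , refl)

⊆⊖⇒⊕⊆ : {L : Pred (𝒯 Y) k} {M : Pred (𝒯 Y) m} {i : ℤ} → L ⊆ M ⊖ i → L ⊕ i ⊆ M
⊆⊖⇒⊕⊆ L⊆M-i (y , j , p , refl) = L⊆M-i p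

⊖-assoc : (M : Pred (𝒯 Y) m) (i j : ℤ) → M ⊖ i ⊖ j ⊆ M ⊖ (j + i)
⊖-assoc M i j {y , l} = subst M (cong (y ,_) (+-assoc l j i))

⊖-assoc⁻¹ : (M : Pred (𝒯 Y) m) (i j : ℤ) → M ⊖ (j + i) ⊆ M ⊖ i ⊖ j
⊖-assoc⁻¹ M i j {y , l} = subst M (cong (y ,_) (sym (+-assoc l j i)))

⊆⊖0 : (M : Pred (𝒯 Y) m) → M ⊆ M ⊖ 0ℤ
⊆⊖0 M {y , j} = subst M (cong (y ,_) (sym (+-identityʳ j)))

⊖0⊆ : (M : Pred (𝒯 Y) m) → M ⊖ 0ℤ ⊆ M
⊖0⊆ M {y , j} = subst M (cong (y ,_) (+-identityʳ j))

-- Truth in `M` quantifies over all shifts, and shift `j` in `M ⊖ i` amounts to shift `j + i` in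
-- `M`.
⊨-⊖ : (M : Pred (𝒯 Y) m) (i : ℤ) {φ : Formula Y} → M ⊨ φ → M ⊖ i ⊨ φ
⊨-⊖ M i {C ⇒ D} M⊨φ j C+j⊆M-i =
  ⊆⊖⇒⊕⊆ {M = M ⊖ i} λ {t} q → ⊖-assoc⁻¹ M i j {t} (D⊆M-[j+i] q)
  where
  C⊆M-[j+i] : ⟦ C ⟧ ⊆ M ⊖ (j + i)
  C⊆M-[j+i] {t} p = ⊖-assoc M i j {t} (⊕⊆⇒⊆⊖ {M = M ⊖ i} C+j⊆M-i p)

  D⊆M-[j+i] : ⟦ D ⟧ ⊆ M ⊖ (j + i)
  D⊆M-[j+i] = ⊕⊆⇒⊆⊖ {M = M} (M⊨φ (j + i) (⊆⊖⇒⊕⊆ {M = M} C⊆M-[j+i]))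

⊆-closure : (Σ : Theory Y s) (M : Pred (𝒯 Y) m) → M ⊆ [ M ]⟨ ℓ , Σ ⟩
⊆-closure Σ M p N N∈Mod M⊆N = M⊆N p

module _ (ℓ : Level) (Σ : Theory Y s) (A B : FinSubset Y) where

  -- Any model `N` containing A contains its closure, hence A + i, hence B + i by (1).
  entails⇒closure⊨ : Σ ⊨⟨ ℓ ⟩ (A ⇒ B) → [ ⟦ A ⟧ ]⟨ ℓ , Σ ⟩ ⊨ (A ⇒ B)
  entails⇒closure⊨ Σ⊨φ i A+i⊆[A] q N N∈Mod A⊆N =
    Σ⊨φ N N∈Mod i (λ p → A+i⊆[A] p N N∈Mod A⊆N) q

  closure⊨⇒⊆closure : [ ⟦ A ⟧ ]⟨ ℓ , Σ ⟩ ⊨ (A ⇒ B) → ⟦ B ⟧ ⊆ [ ⟦ A ⟧ ]⟨ ℓ , Σ ⟩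
  closure⊨⇒⊆closure [A]⊨φ = ⊖0⊆ [A] ∘ ⊕⊆⇒⊆⊖ {M = [A]}
    ([A]⊨φ 0ℤ (⊆⊖⇒⊕⊆ {M = [A]} (⊆⊖0 [A] ∘ ⊆-closure Σ ⟦ A ⟧)))
    where [A] = [ ⟦ A ⟧ ]⟨ ℓ , Σ ⟩

  ⊆closure⇒entails : ⟦ B ⟧ ⊆ [ ⟦ A ⟧ ]⟨ ℓ , Σ ⟩ → Σ ⊨⟨ ℓ ⟩ (A ⇒ B)
  ⊆closure⇒entails B⊆[A] M M∈Mod i A+i⊆M = ⊆⊖⇒⊕⊆ {M = M} λ q →
    B⊆[A] q (M ⊖ i) (⊨-⊖ M i ∘ M∈Mod) (⊕⊆⇒⊆⊖ {M = M} A+i⊆M)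

theorem4 : ∀ {s : Level} (ℓ : Level) (n : ℕ) (Y : Set) → Y ↔ Fin (suc n) →
    (Σ : Theory Y s) (A B : FinSubset Y) →
    (Σ ⊨⟨ ℓ ⟩ (A ⇒ B) ⇔ [ ⟦ A ⟧ ]⟨ ℓ , Σ ⟩ ⊨ (A ⇒ B)) ×
    ([ ⟦ A ⟧ ]⟨ ℓ , Σ ⟩ ⊨ (A ⇒ B) ⇔ ⟦ B ⟧ ⊆ [ ⟦ A ⟧ ]⟨ ℓ , Σ ⟩)
theorem4 ℓ n Y _ Σ A B = mk⇔ 1⇒2 (3⇒1 ∘ 2⇒3) , mk⇔ 2⇒3 (1⇒2 ∘ 3⇒1)
  where
  1⇒2 = entails⇒closure⊨ ℓ Σ A B
  2⇒3 : [ ⟦ A ⟧ ]⟨ ℓ , Σ ⟩ ⊨ (A ⇒ B) → ⟦ B ⟧ ⊆ [ ⟦ A ⟧ ]⟨ ℓ , Σ ⟩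
  2⇒3 = closure⊨⇒⊆closure ℓ Σ A B
  3⇒1 : ⟦ B ⟧ ⊆ [ ⟦ A ⟧ ]⟨ ℓ , Σ ⟩ → Σ ⊨⟨ ℓ ⟩ (A ⇒ B)
  3⇒1 = ⊆closure⇒entails ℓ Σ A B
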